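{- Let $\kappa$ be an uncountable regular cardinal and let $\mathcal{I}$ be a $\kappa$-complete proper ideal on $\kappa$ containing every bounded subset of $\kappa$, and suppose $\mathcal{I}$ contains an unbounded subset of $\kappa$. Let $\nu\in\{2,\kappa\}$. Then the class of $\mathcal{I}$-analytic subsets of ${}^{\kappa}\nu$ is closed under unions of at most $2^\kappa$ sets.
   Context: Work in ZFC. For $\mu\in\{2,\kappa\}$, ${}^{\kappa}\mu$ is the set of functions $\kappa\to\mu$. For $f\colon D\to\mu$ with $D\in\mathcal{I}$ let $\mathbf{N}_f=\{x\in{}^{\kappa}\mu: f\subseteq x\}$; the $\mathcal{I}$-topology $\tau_{\mathcal{I}}$ on ${}^{\kappa}\mu$ is generated by these sets. A function ${}^{\kappa}\kappa\to{}^{\kappa}\nu$ is $\mathcal{I}$-continuous if it is continuous when both spaces carry $\tau_{\mathcal{I}}$. A set $A\subseteq{}^{\kappa}\nu$ is $\mathcal{I}$-analytic if either $A=\emptyset$ or there are a $\tau_{\mathcal{I}}$-closed set $C\subseteq{}^{\kappa}\kappa$ and an $\mathcal{I}$-continuous function $\Phi\colon{}^{\kappa}\kappa\to{}^{\kappa}\nu$ with $\Phi(C)=A$. -}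

module Defs where

open import Level using (_⊔_; suc)
open import Data.List using (List)
open import Data.List.Relation.Unary.All using (All)
open import Data.Nat using (ℕ)
open import Data.Bool using (Bool)
open import Data.Product using (Σ-syntax; ∃-syntax; _×_)
open import Data.Sum using (_⊎_)
open import Function.Bundles using (_↣_)
open import Function.Definitions using (Injective)
open import Relation.Binary.Core using (Rel)
open import Relation.Binary.PropositionalEquality using (_≡_)
open import Relation.Binary.Structures using (IsStrictTotalOrder)
open import Relation.Nullary using (¬_)
open import Relation.Unary
open import Induction.WellFounded using (WellFounded)

image : ∀ {x y p} {X : Set x} {Y : Set y} → (X → Y) → Pred X p → Pred Y (x ⊔ y ⊔ p)
image f P = λ y → ∃[ x ] (x ∈ P × f x ≡ y)

-- |J| < |K|
_≺_ : ∀ {j k} → Set j → Set k → Set (j ⊔ k)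
J ≺ K = (J ↣ K) × ¬ (K ↣ J)

module _ {a} {κ : Set a} (_<_ : Rel κ a) where

  Bounded : ∀ {p} → Pred κ p → Set (a ⊔ p)
  Bounded S = ∃[ γ ] (∀ α → α ∈ S → α < γ)

  Unbounded : ∀ {p} → Pred κ p → Set (a ⊔ p)
  Unbounded S = ¬ Bounded S

  -- A cardinal is an initial ordinal: a well-order that does not inject into
  -- any of its proper initial segments {β | β < α}.
  record IsCardinal : Set a where
    field
      isStrictTotalOrder : IsStrictTotalOrder _≡_ _<_
      wellFounded        : WellFounded _<_
      initial            : ∀ α (f : κ → κ) → Injective _≡_ _≡_ f → ¬ (∀ β → f β < α)

  -- cof(κ) = κ: no map from a set of size < κ has unbounded range.
  record IsUncountableRegularCardinal : Set (suc a) where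
    field
      isCardinal  : IsCardinal
      uncountable : ¬ (κ ↣ ℕ)
      regular     : ∀ {J : Set a} → J ≺ κ → (f : J → κ) → Bounded (image f U)

module _ {a ℓ} {κ : Set a} (𝓘 : Pred (Pred κ a) ℓ) where

  record IsIdeal : Set (suc a ⊔ ℓ) where
    field
      empty    : ∀ {A} → Empty A → A ∈ 𝓘
      downward : ∀ {A B} → B ⊆ A → A ∈ 𝓘 → B ∈ 𝓘
      union    : ∀ {A B} → A ∈ 𝓘 → B ∈ 𝓘 → (A ∪ B) ∈ 𝓘

  Proper : Set (suc a ⊔ ℓ)
  Proper = ∀ {A} → Universal A → A ∉ 𝓘

  -- κ-completeness: closure under unions of fewer than κ sets.
  Complete : Set (suc a ⊔ ℓ)
  Complete = ∀ {J : Set a} → J ≺ κ → (A : J → Pred κ a) →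
             (∀ j → A j ∈ 𝓘) → ⋃ J A ∈ 𝓘

-- Openness in the topology generated by a family 𝒮 of sets: U is a union of
-- finite intersections of members of 𝒮 (the empty intersection being X).
GeneratedOpen : ∀ {x i p q} {X : Set x} {I : Set i} →
                (I → Pred X p) → Pred X q → Set (x ⊔ i ⊔ p ⊔ q)
GeneratedOpen {I = I} 𝒮 U =
  ∀ x → x ∈ U → Σ[ is ∈ List I ]
    (All (λ i → x ∈ 𝒮 i) is × (∀ y → All (λ i → y ∈ 𝒮 i) is → y ∈ U))

module _ {a ℓ} {κ : Set a} (𝓘 : Pred (Pred κ a) ℓ) where

  -- A function f : D → μ with D ∈ 𝓘.  The membership argument is irrelevant
  -- so that the value depends on the element of D only, not on the proof.
  record PartialFunction {m} (μ : Set m) : Set (suc a ⊔ ℓ ⊔ m) where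
    field
      dom     : Pred κ a
      dom∈𝓘   : dom ∈ 𝓘
      value   : ∀ α → .(α ∈ dom) → μ

  module _ {m} {μ : Set m} where

    𝐍 : PartialFunction μ → Pred (κ → μ) (a ⊔ m)
    𝐍 f = λ x → ∀ α (α∈D : α ∈ dom) → x α ≡ value α α∈D
      where open PartialFunction f

    Open : ∀ {p} → Pred (κ → μ) p → Set (suc a ⊔ ℓ ⊔ m ⊔ p)
    Open = GeneratedOpen 𝐍

    Closed : ∀ {p} → Pred (κ → μ) p → Set (suc a ⊔ ℓ ⊔ m ⊔ p)
    Closed C = Open (∁ C)

  Continuous : ∀ {m n} {μ : Set m} {ν : Set n} → ((κ → μ) → (κ → ν)) →
               Set (suc a ⊔ ℓ ⊔ m ⊔ suc n)
  Continuous {n = n} {ν = ν} Φ = ∀ (V : Pred (κ → ν) (a ⊔ n)) → Open V → Open (Φ ⊢ V)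

  Analytic : ∀ {n} {ν : Set n} → Pred (κ → ν) (a ⊔ n) → Set (suc a ⊔ ℓ ⊔ suc n)
  Analytic {ν = ν} A =
    Empty A ⊎
    (Σ[ C ∈ Pred (κ → κ) a ] Σ[ Φ ∈ ((κ → κ) → (κ → ν)) ]
      (Closed C × Continuous Φ × image Φ C ≐ A))

  -- The family is indexed by a set J with |J| ≤ 2^κ.
  AnalyticClosedUnder2^κUnions : ∀ {n} → Set n → Set (suc a ⊔ ℓ ⊔ suc n)
  AnalyticClosedUnder2^κUnions {n} ν =
    ∀ {J : Set a} → J ↣ (κ → Bool) → (A : J → Pred (κ → ν) (a ⊔ n)) →
    (∀ j → Analytic (A j)) → Analytic (⋃ J A)

{-# OPTIONS --safe #-}

-- Pairing a bit with an ordinal through an injection κ × 2 → κ, a point of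
-- κ^κ carries both a point π x of κ^κ and a bit at every coordinate.  Let
-- S ∈ 𝓘 be unbounded.  As |S| = κ, the bits on S spell out an arbitrary element
-- code x of 2^κ, and code is locally constant, since x restricted to S
-- determines code x and S ∈ 𝓘.  Given a family of pairs (C_c, Φ_c) indexed by
-- c ∈ 2^κ, the set {x | π x ∈ C_(code x)} and the function
-- x ↦ Φ_(code x) (π x) then present the union of the sets Φ_c(C_c).
module Submission where

open import Defs
open import Axiom.ExcludedMiddle using (ExcludedMiddle)
open import Axiom.Extensionality.Propositional using (Extensionality; implicit-extensionality)
open import Data.Bool using (Bool; true; false)
open import Data.Empty using (⊥; ⊥-elim)
open import Data.Irrelevant using ([_])
open import Data.List using ([]; _∷_; map)
open import Data.List.Relation.Unary.All as All using (All; []; _∷_)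
open import Data.List.Relation.Unary.All.Properties using (map⁺; map⁻)
open import Data.Product using (_×_; ∃-syntax; Σ-syntax; _,_; proj₁; proj₂)
open import Data.Refinement using (Refinement; _,_; value)
open import Data.Sum using (inj₁; inj₂)
open import Data.Unit using (tt)
open import Data.Unit.Polymorphic using (⊤)
open import Function using (const; _∘_)
open import Function.Bundles using (_↣_; mk↣; module Injection)
open import Function.Definitions using (Injective)
open import Induction.WellFounded using (module All; module FixPoint; WfRec)
open import Level using (Level; _⊔_; Lift; lower; suc)
open import Relation.Binary.Core using (Rel)
open import Relation.Binary.Definitions using (tri<; tri≈; tri>)
open import Relation.Binary.PropositionalEquality using (_≡_; refl; sym; trans; cong; subst)
open import Relation.Binary.Structures using (IsStrictTotalOrder)
open import Relation.Nullary using (¬_; Dec; yes; no; recompute; contradiction)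
open import Relation.Unary using (Pred; _∈_; _⊆_; _≐_; ∁; U; ⋃; _⊢_; Empty)

leftInverse : (∀ {ℓ} → ExcludedMiddle ℓ) →
  ∀ {x y} {X : Set x} {Y : Set y} → X → (f : X → Y) → Injective _≡_ _≡_ f →
  Σ[ g ∈ (Y → X) ] (∀ x → g (f x) ≡ x)
leftInverse em {X = X} {Y} x₀ f inj = (λ y → preimage y em) , λ x → preimage-f x em
  where
  preimage : ∀ y → Dec (∃[ x ] f x ≡ y) → X
  preimage y (yes (x , _)) = x
  preimage y (no _)        = x₀

  preimage-f : ∀ x (d : Dec (∃[ x′ ] f x′ ≡ f x)) → preimage (f x) d ≡ x
  preimage-f x (yes (_ , eq)) = inj eq
  preimage-f x (no ∄)         = contradiction (x , refl) ∄

-- Regular cardinals: successors, sparse sequences, pairing with a bit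

module RegularCardinal
  (em : ∀ {ℓ} → ExcludedMiddle ℓ) (ext : ∀ {ℓ₁ ℓ₂} → Extensionality ℓ₁ ℓ₂)
  {a : Level} {κ : Set a} (_<_ : Rel κ a) (κ-regular : IsUncountableRegularCardinal _<_)
  where

  open IsUncountableRegularCardinal κ-regular
  open IsCardinal isCardinal
  open IsStrictTotalOrder isStrictTotalOrder
    using (compare; irrefl) renaming (trans to <-trans)

  inhabitant : κ
  inhabitant with em {P = κ}
  ... | yes α = α
  ... | no ∄  = contradiction (mk↣ {to = ⊥-elim ∘ ∄} λ {α} → ⊥-elim (∄ α)) uncountable

  -- The bounds are irrelevant so that the elements of an initial segment are
  -- determined by their values: proofs of _<_ need not be unique.
  Segment : κ → Set a
  Segment α = Refinement κ (_< α)

  below : ∀ {α} (s : Segment α) → value s < α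
  below (β , [ β<α ]) = recompute em β<α

  segment≺κ : ∀ α → Segment α ≺ κ
  segment≺κ α =
    mk↣ {to = value} (λ { refl → refl }) ,
    λ f → let open Injection f in
      initial α (value ∘ to) (λ eq → injective (value-injective eq)) (below ∘ to)
    where
    value-injective : ∀ {s t : Segment α} → value s ≡ value t → s ≡ t
    value-injective refl = refl

  ⊤≺κ : ⊤ {a} ≺ κ
  ⊤≺κ = mk↣ {to = const inhabitant} (λ _ → refl) ,
    λ f → uncountable (mk↣ {to = const 0} λ _ → Injection.injective f refl)

  noMaximum : ∀ α → ∃[ β ] α < β
  -- Bounds are strict, so a bound of the one-element family `const α` lies above `α`.
  noMaximum α with regular ⊤≺κ (const α)
  ... | β , α<β = β , α<β α (_ , tt , refl)

  next : κ → κ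
  next = proj₁ ∘ noMaximum

  <-next : ∀ α → α < next α
  <-next = proj₂ ∘ noMaximum

  <-mono⇒injective : (f : κ → κ) → (∀ {α β} → α < β → f α < f β) → Injective _≡_ _≡_ f
  <-mono⇒injective f mono {α} {β} eq with compare α β
  ... | tri< α<β _ _ = contradiction (mono α<β) (irrefl eq)
  ... | tri≈ _ α≡β _ = α≡β
  ... | tri> _ _ β<α = contradiction (mono β<α) (irrefl (sym eq))

  unbounded⇒above : ∀ {p} {T : Pred κ p} → Unbounded _<_ T → ∀ γ → ∃[ τ ] (τ ∈ T × γ < τ)
  unbounded⇒above {T = T} T-unbounded γ with em {P = ∃[ τ ] (τ ∈ T × γ < τ)}
  ... | yes above = above
  -- The bound is `next γ` and not `γ`, because bounds are strict and `γ` itself may lie in `T`.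
  ... | no ∄      = contradiction (next γ , bound) T-unbounded
    where
    bound : ∀ τ → τ ∈ T → τ < next γ
    bound τ τ∈T with compare τ γ
    ... | tri< τ<γ _ _  = <-trans τ<γ (<-next γ)
    ... | tri≈ _ refl _ = <-next γ
    ... | tri> _ _ γ<τ  = contradiction (τ , τ∈T , γ<τ) ∄

  module SparseSequence {p} {T : Pred κ p} (T-unbounded : Unbounded _<_ T) where

    private
      -- Fewer than κ values precede stage `α`, so by regularity their successors have a common
      -- bound, and the unbounded `T` has an element above it. Clearing `next` of each earlier value
      -- leaves a gap that `pair` fills.
      step : ∀ α (IH : WfRec _<_ (const κ) α) →
        ∃[ τ ] (τ ∈ T × ∀ (s : Segment α) → next (IH (below s)) < τ)
      step α IH with regular (segment≺κ α) (λ s → next (IH (below s)))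
      ... | γ , <γ with unbounded⇒above T-unbounded γ
      ...   | τ , τ∈T , γ<τ = τ , τ∈T , λ s → <-trans (<γ _ (s , tt , refl)) γ<τ

      step-ext : ∀ α {IH IH′ : WfRec _<_ (const κ) α} →
        (∀ {β} β<α → IH {β} β<α ≡ IH′ β<α) → proj₁ (step α IH) ≡ proj₁ (step α IH′)
      step-ext α eq =
        cong (λ (IH : WfRec _<_ (const κ) α) → proj₁ (step α IH))
          (implicit-extensionality ext (ext eq))

    sequence : κ → κ
    sequence = All.wfRec wellFounded a (const κ) (λ α IH → proj₁ (step α IH))

    private
      sequence-unfold : ∀ α → sequence α ≡ proj₁ (step α (λ {β} _ → sequence β))
      sequence-unfold α =
        FixPoint.unfold-wfRec wellFounded (const κ) (λ α IH → proj₁ (step α IH)) step-ext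

    sequence-∈ : ∀ α → sequence α ∈ T
    sequence-∈ α = subst T (sym (sequence-unfold α)) (proj₁ (proj₂ (step α (λ _ → sequence _))))

    sequence-sparse : ∀ {α β} → β < α → next (sequence β) < sequence α
    sequence-sparse {α} {β} β<α =
      subst (next (sequence β) <_) (sym (sequence-unfold α))
        (proj₂ (proj₂ (step α (λ _ → sequence _))) (β , [ β<α ]))

    sequence-mono : ∀ {β α} → β < α → sequence β < sequence α
    sequence-mono β<α = <-trans (<-next _) (sequence-sparse β<α)

    sequence-injective : Injective _≡_ _≡_ sequence
    sequence-injective = <-mono⇒injective sequence sequence-mono

  module BitPairing where

    open SparseSequence {T = U {A = κ}} (λ (γ , <γ) → irrefl refl (<γ γ tt))

    -- The two codes for `α` are `sequence α` and its `next`. Sparseness puts both below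
    -- `sequence β` for every later `β`, so the bits never disturb the order of the second
    -- components.
    pair : Bool × κ → κ
    pair (false , α) = sequence α
    pair (true  , α) = next (sequence α)

    pair-< : ∀ b c {α β} → α < β → pair (b , α) < pair (c , β)
    pair-< false false α<β = sequence-mono α<β
    pair-< false true  α<β = <-trans (sequence-mono α<β) (<-next _)
    pair-< true  false α<β = sequence-sparse α<β
    pair-< true  true  α<β = <-trans (sequence-sparse α<β) (<-next _)

    pair-injective : Injective _≡_ _≡_ pair
    pair-injective {b , α} {c , β} eq with compare α β
    ... | tri< α<β _ _ = contradiction (pair-< b c α<β) (irrefl eq)
    ... | tri> _ _ β<α = contradiction (pair-< c b β<α) (irrefl (sym eq))
    pair-injective {false , α} {false , α} eq | tri≈ _ refl _ = refl
    pair-injective {false , α} {true  , α} eq | tri≈ _ refl _ =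
      contradiction (<-next _) (irrefl eq)
    pair-injective {true  , α} {false , α} eq | tri≈ _ refl _ =
      contradiction (<-next _) (irrefl (sym eq))
    pair-injective {true  , α} {true  , α} eq | tri≈ _ refl _ = refl

    unpair : κ → Bool × κ
    unpair = proj₁ (leftInverse em (false , inhabitant) pair pair-injective)

    unpair-pair : ∀ p → unpair (pair p) ≡ p
    unpair-pair = proj₂ (leftInverse em (false , inhabitant) pair pair-injective)

-- Presentations of analytic sets

-- The nonempty case of the definition of Analytic, in which C may nevertheless be empty.
Presented : ∀ {a ℓ n} {κ : Set a} (𝓘 : Pred (Pred κ a) ℓ) {ν : Set n} →
  Pred (κ → ν) (a ⊔ n) → Set (suc a ⊔ ℓ ⊔ suc n)
Presented {a} {κ = κ} 𝓘 {ν} A =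
  Σ[ C ∈ Pred (κ → κ) a ] Σ[ Φ ∈ ((κ → κ) → (κ → ν)) ]
    (Closed 𝓘 C × Continuous 𝓘 Φ × image Φ C ≐ A)

-- The empty set is the image of the empty closed set under a constant function; `v` supplies the
-- constant. The empty intersection of generators serves as neighbourhood throughout.
empty-presented : ∀ {a ℓ n} {κ : Set a} (𝓘 : Pred (Pred κ a) ℓ) {ν : Set n} → ν →
  {A : Pred (κ → ν) (a ⊔ n)} → Empty A → Presented 𝓘 A
empty-presented {a} 𝓘 v ∅ =
  const (Lift a ⊥) , const (const v) ,
  (λ _ _ → [] , [] , λ _ _ → lower) ,
  (λ _ _ _ v∈V → [] , [] , λ _ _ → v∈V) ,
  (λ ()) , λ {y} y∈A → contradiction y∈A (∅ y)

analytic⇒presented : ∀ {a ℓ n} {κ : Set a} (𝓘 : Pred (Pred κ a) ℓ) {ν : Set n} → ν →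
  {A : Pred (κ → ν) (a ⊔ n)} → Analytic 𝓘 A → Presented 𝓘 A
analytic⇒presented 𝓘 v (inj₁ ∅) = empty-presented 𝓘 v ∅
analytic⇒presented 𝓘 v (inj₂ p) = p

presented-resp-≐ : ∀ {a ℓ n} {κ : Set a} (𝓘 : Pred (Pred κ a) ℓ) {ν : Set n}
  {A B : Pred (κ → ν) (a ⊔ n)} → A ≐ B → Presented 𝓘 A → Presented 𝓘 B
presented-resp-≐ 𝓘 (A⊆B , B⊆A) (C , Φ , C-closed , Φ-continuous , image⊆A , A⊆image) =
  C , Φ , C-closed , Φ-continuous , (λ z → A⊆B (image⊆A z)) , λ z → A⊆image (B⊆A z)

-- Open sets and pointwise maps

module Restriction {a ℓ} {κ : Set a} (𝓘 : Pred (Pred κ a) ℓ) where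

  restrict : ∀ {m} {μ : Set m} (x : κ → μ) {D : Pred κ a} → D ∈ 𝓘 → PartialFunction 𝓘 μ
  restrict x {D} D∈𝓘 = record { dom = D ; dom∈𝓘 = D∈𝓘 ; value = λ α _ → x α }

  -- Pointwise maps are 𝓘-continuous because they do not enlarge domains, even
  -- when supplemented by the knowledge of x on one set D of 𝓘.
  open-pointwise : ∀ {m n p q} {μ : Set m} {ν : Set n} (f : μ → ν) {D : Pred κ a} → D ∈ 𝓘 →
    {W : Pred (κ → μ) p} →
    (∀ x → x ∈ W → Σ[ V ∈ Pred (κ → ν) q ]
      (Open 𝓘 V × f ∘ x ∈ V × (∀ y → (∀ α → α ∈ D → y α ≡ x α) → f ∘ y ∈ V → y ∈ W))) →
    Open 𝓘 W
  open-pointwise f D∈𝓘 local x x∈W with local x x∈W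
  ... | V , V-open , fx∈V , V⇒W with V-open (f ∘ x) fx∈V
  ...   | is , fx∈is , is⇒V =
    -- The neighbourhood fixes `x` on `D` and on the domain of each generator around `f ∘ x`;
    -- agreement with `x` there carries over to agreement after `f`.
    restrict x D∈𝓘 ∷ map (λ i → restrict x (PartialFunction.dom∈𝓘 i)) is ,
    (λ _ _ → refl) ∷ map⁺ (All.map (λ _ _ _ → refl) fx∈is) ,
    λ { y (y≡x ∷ y∈is) →
      V⇒W y y≡x (is⇒V (f ∘ y) (All.zipWith
        (λ (fx∈i , y≡x) α α∈D → trans (cong f (y≡x α α∈D)) (fx∈i α α∈D))
        (fx∈is , map⁻ y∈is))) }

-- Unions of families indexed by codes

module UnionOverCodes
  (em : ∀ {ℓ} → ExcludedMiddle ℓ) (ext : ∀ {ℓ₁ ℓ₂} → Extensionality ℓ₁ ℓ₂)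
  {a ℓ : Level} {κ : Set a} (_<_ : Rel κ a) (κ-regular : IsUncountableRegularCardinal _<_)
  (𝓘 : Pred (Pred κ a) ℓ) (unboundedMember : ∃[ S ] (S ∈ 𝓘 × Unbounded _<_ S))
  where

  open RegularCardinal em ext _<_ κ-regular
  open BitPairing
  open Restriction 𝓘

  private
    S : Pred κ a
    S = proj₁ unboundedMember

    S∈𝓘 : S ∈ 𝓘
    S∈𝓘 = proj₁ (proj₂ unboundedMember)

    open SparseSequence (proj₂ (proj₂ unboundedMember))

    index : Σ[ i ∈ (κ → κ) ] (∀ α → i (sequence α) ≡ α)
    index = leftInverse em inhabitant sequence sequence-injective

  -- Only coordinates listed by `sequence` are read. They lie in `S`, which makes `code` local, and
  -- they are indexed by all of κ, which makes every element of 2^κ a code.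
  code : (κ → κ) → (κ → Bool)
  code x α = proj₁ (unpair (x (sequence α)))

  π : (κ → κ) → (κ → κ)
  π x = proj₂ ∘ unpair ∘ x

  code-local : ∀ {x y} → (∀ α → α ∈ S → y α ≡ x α) → code y ≡ code x
  code-local y≡x = ext λ α → cong (proj₁ ∘ unpair) (y≡x _ (sequence-∈ α))

  code-π-surjective : ∀ c y → ∃[ x ] (code x ≡ c × π x ≡ y)
  code-π-surjective c y = x , ext code-x , ext λ α → cong proj₂ (unpair-pair (c (proj₁ index α) , y α))
    where
    x : κ → κ
    -- Off the range of `sequence` the index is a default value; the resulting bit is harmless,
    -- since `code` never reads it.
    x β = pair (c (proj₁ index β) , y β)

    code-x : ∀ α → code x α ≡ c α
    code-x α = trans
      (cong proj₁ (unpair-pair (c (proj₁ index (sequence α)) , y (sequence α))))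
      (cong c (proj₂ index α))

  presented-⋃ : ∀ {n} {ν : Set n} (A : (κ → Bool) → Pred (κ → ν) (a ⊔ n)) →
    (∀ c → Presented 𝓘 (A c)) → Presented 𝓘 (⋃ (κ → Bool) A)
  presented-⋃ {ν = ν} A presented = C , Φ , C-closed , Φ-continuous , image⊆⋃ , ⋃⊆image
    where
    C′ : (κ → Bool) → Pred (κ → κ) a
    C′ c = proj₁ (presented c)

    Φ′ : (κ → Bool) → (κ → κ) → (κ → ν)
    Φ′ c = proj₁ (proj₂ (presented c))

    C : Pred (κ → κ) a
    C x = π x ∈ C′ (code x)

    Φ : (κ → κ) → (κ → ν)
    Φ x = Φ′ (code x) (π x)

    C-closed : Closed 𝓘 C
    -- Among the points agreeing with `x` on `S` the code is constant, so there `C` is the preimage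
    -- under `π` of the single closed set `C′ (code x)`.
    C-closed = open-pointwise (proj₂ ∘ unpair) S∈𝓘 λ x x∉C →
      ∁ (C′ (code x)) , proj₁ (proj₂ (proj₂ (presented (code x)))) , x∉C ,
      λ y y≡x → subst (λ c → π y ∈ ∁ (C′ c)) (sym (code-local y≡x))

    Φ-continuous : Continuous 𝓘 Φ
    Φ-continuous V V-open = open-pointwise (proj₂ ∘ unpair) S∈𝓘 λ x Φx∈V →
      Φ′ (code x) ⊢ V ,
      proj₁ (proj₂ (proj₂ (proj₂ (presented (code x))))) V V-open , Φx∈V ,
      λ y y≡x → subst (λ c → Φ′ c (π y) ∈ V) (sym (code-local y≡x))

    image-Φ′ : ∀ c → image (Φ′ c) (C′ c) ≐ A c
    image-Φ′ c = proj₂ (proj₂ (proj₂ (proj₂ (presented c))))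

    image⊆⋃ : image Φ C ⊆ ⋃ (κ → Bool) A
    image⊆⋃ (x , x∈C , Φx≡z) = code x , proj₁ (image-Φ′ (code x)) (π x , x∈C , Φx≡z)

    ⋃⊆image : ⋃ (κ → Bool) A ⊆ image Φ C
    ⋃⊆image (c , z∈Ac) with proj₂ (image-Φ′ c) z∈Ac
    ... | y , y∈C , Φy≡z with code-π-surjective c y
    ...   | x , refl , refl = x , y∈C , Φy≡z

  analytic-⋃ : ∀ {n} {ν : Set n} → ν → AnalyticClosedUnder2^κUnions 𝓘 ν
  analytic-⋃ {n} {ν} v {J} J↣2^κ A analytic =
    inj₂ (presented-resp-≐ 𝓘 B≐A (presented-⋃ B λ c → B-presented c em))
    where
    open Injection J↣2^κ

    -- Reindexes the family by all of 2^κ: a code outside the image of `to` receives the empty set,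
    -- and injectivity of `to` leaves exactly `A j` at `to j`.
    B : (κ → Bool) → Pred (κ → ν) (a ⊔ n)
    B c z = Σ[ j ∈ J ] (to j ≡ c × z ∈ A j)

    B≐A : ⋃ (κ → Bool) B ≐ ⋃ J A
    B≐A = (λ (_ , j , _ , z∈Aj) → j , z∈Aj) , λ (j , z∈Aj) → to j , j , refl , z∈Aj

    B-presented : ∀ c → Dec (∃[ j ] to j ≡ c) → Presented 𝓘 (B c)
    B-presented c (no ∄) = empty-presented 𝓘 v λ _ (j , eq , _) → ∄ (j , eq)
    B-presented c (yes (j , refl)) =
      presented-resp-≐ 𝓘 (Aj⊆B , B⊆Aj) (analytic⇒presented 𝓘 v (analytic j))
      where
      Aj⊆B : A j ⊆ B (to j)
      Aj⊆B z∈Aj = j , refl , z∈Aj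

      B⊆Aj : B (to j) ⊆ A j
      B⊆Aj {z} (j′ , eq , z∈Aj′) = subst (λ j → z ∈ A j) (injective eq) z∈Aj′

theorem5p2 : (∀ {ℓ} → ExcludedMiddle ℓ) →
    (∀ {ℓ₁ ℓ₂} → Extensionality ℓ₁ ℓ₂) →
    ∀ {a ℓ} {κ : Set a} (_<_ : Rel κ a) →
    IsUncountableRegularCardinal _<_ →
    (𝓘 : Pred (Pred κ a) ℓ) →
    IsIdeal 𝓘 →
    Complete 𝓘 →
    Proper 𝓘 →
    (∀ S → Bounded _<_ S → S ∈ 𝓘) →
    ∃[ S ] (S ∈ 𝓘 × Unbounded _<_ S) →
    AnalyticClosedUnder2^κUnions 𝓘 Bool × AnalyticClosedUnder2^κUnions 𝓘 κ
theorem5p2 em ext _<_ κ-regular 𝓘 _ _ _ _ unboundedMember =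
  analytic-⋃ false , analytic-⋃ inhabitant
  where
  open RegularCardinal em ext _<_ κ-regular using (inhabitant)
  open UnionOverCodes em ext _<_ κ-regular 𝓘 unboundedMember using (analytic-⋃)
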